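{- Let $\mathbf{P}=\{p_n(x)\}_{n\ge0}$ be a sequence of complex polynomials with $\deg p_n=n$, $p_0=1$, and $p_n(0)=0$ for all $n\ge1$. Then for $n\ge1$ and $1\le k\le n$, $$S_2(n,k;\mathbf{P})=\frac{1}{k!}\sum_{j=1}^{k}\binom{n-j}{k-j}A_{n,j-1}(\mathbf{P}).$$
   Context: $S_2(n,k;\mathbf{P})$ is defined by $p_n(x)=\sum_{k=0}^{n}S_2(n,k;\mathbf{P})(x)_k$, with $(x)_0=1$, $(x)_k=x(x-1)\cdots(x-k+1)$. The Eulerian numbers $A_{n,k}(\mathbf{P})$ ($0\le k\le n$) are the unique coefficients with $p_n(x)=\sum_{k=0}^{n}A_{n,k}(\mathbf{P})\binom{x+n-k-1}{n}$, where $\binom{y}{n}=y(y-1)\cdots(y-n+1)/n!$. -}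

module Defs where

open import Algebra.Bundles using (CommutativeRing; RawMonoid)
import Algebra.Consequences.Setoid as Consequences
import Algebra.Definitions.RawMonoid as RawMonoidDefs
import Algebra.Solver.Ring as RingSolver
open import Algebra.Solver.Ring.AlmostCommutativeRing
  using (_-Raw-AlmostCommutative⟶_; fromCommutativeRing)
open import Data.Fin.Base using (toℕ)
open import Data.Integer.Base as ℤ using ()
open import Data.List.Base using (List; []; _∷_; map)
open import Data.Maybe.Base as Maybe using (Maybe)
open import Data.Nat.Base as ℕ using (ℕ; zero; suc; _⊓_; _!)
import Data.Nat.Properties as ℕₚ
open import Data.Product.Base using (∃; _×_; _,_)
open import Data.Rational.Base as ℚ using (ℚ; 0ℚ; 1ℚ; ½; ∣_∣)
import Data.Rational.Properties as ℚₚ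
open import Data.Rational.Solver using (module +-*-Solver)
open import Level using (0ℓ)
open import Relation.Binary.Bundles using (Setoid)
open import Relation.Binary.PropositionalEquality
  using (_≡_; refl; sym; trans; cong; subst)
open import Relation.Binary.Structures using (IsEquivalence)
open import Relation.Nullary.Decidable.Core using (dec⇒maybe)
open import Relation.Nullary.Negation.Core using (¬_)

private
  variable
    I : Set

-- u tends to 0 along the indices i whose level tends to infinity.
record Vanishing {I : Set} (level : I → ℕ) (u : I → ℚ) : Set where
  constructor mkVanishing
  field
    eventually : ∀ ε → 0ℚ ℚ.< ε →
                 ∃ λ N → ∀ i → N ℕ.≤ level i → ∣ u i ∣ ℚ.< ε

open Vanishing public

-- The level m ⊓ n is at least N exactly when both m and n are.
Cauchy : (ℕ → ℚ) → Set
Cauchy x = Vanishing {ℕ × ℕ} (λ (m , n) → m ⊓ n) (λ (m , n) → x m ℚ.- x n)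

record ℝ : Set where
  constructor mkℝ
  field
    seq    : ℕ → ℚ
    cauchy : Cauchy seq

open ℝ public

infix 4 _≈ᴿ_

record _≈ᴿ_ (x y : ℝ) : Set where
  constructor mk≈ᴿ
  field
    difference→0 : Vanishing (λ n → n) (λ n → seq x n ℚ.- seq y n)

open _≈ᴿ_ public

private
  module _ {level : I → ℕ} where

    vanishing-cong : ∀ {u v} → (∀ i → u i ≡ v i) →
                     Vanishing level u → Vanishing level v
    vanishing-cong u≡v u→0 = mkVanishing λ ε 0<ε →
      let N , bound = eventually u→0 ε 0<ε in
      N , λ i N≤i → subst (λ q → ∣ q ∣ ℚ.< ε) (u≡v i) (bound i N≤i)

    vanishing-0 : Vanishing level (λ _ → 0ℚ)
    vanishing-0 = mkVanishing λ ε 0<ε → 0 , λ _ _ → 0<ε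

    vanishing-neg : ∀ {u} → Vanishing level u →
                    Vanishing level (λ i → ℚ.- u i)
    vanishing-neg {u} u→0 = mkVanishing λ ε 0<ε →
      let N , bound = eventually u→0 ε 0<ε in
      N , λ i N≤i → subst (ℚ._< ε) (sym (ℚₚ.∣-p∣≡∣p∣ (u i))) (bound i N≤i)

    vanishing-+ : ∀ {u v} → Vanishing level u → Vanishing level v →
                  Vanishing level (λ i → u i ℚ.+ v i)
    vanishing-+ {u} {v} u→0 v→0 = mkVanishing λ ε 0<ε →
        combine ε (eventually u→0 (ε/2 ε) (0<ε/2 0<ε))
                  (eventually v→0 (ε/2 ε) (0<ε/2 0<ε))
      where
      ε/2 : ℚ → ℚ
      ε/2 ε = ½ ℚ.* ε

      0<ε/2 : ∀ {ε} → 0ℚ ℚ.< ε → 0ℚ ℚ.< ε/2 ε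
      0<ε/2 = ℚₚ.*-monoʳ-<-pos ½

      halves : ∀ ε → ε/2 ε ℚ.+ ε/2 ε ≡ ε
      halves ε = trans (sym (ℚₚ.*-distribʳ-+ ε ½ ½)) (ℚₚ.*-identityˡ ε)

      combine : ∀ ε →
                (∃ λ N → ∀ i → N ℕ.≤ level i → ∣ u i ∣ ℚ.< ε/2 ε) →
                (∃ λ N → ∀ i → N ℕ.≤ level i → ∣ v i ∣ ℚ.< ε/2 ε) →
                ∃ λ N → ∀ i → N ℕ.≤ level i → ∣ u i ℚ.+ v i ∣ ℚ.< ε
      combine ε (M , u<) (N , v<) = M ℕ.⊔ N , λ i M⊔N≤i →
        ℚₚ.≤-<-trans (ℚₚ.∣p+q∣≤∣p∣+∣q∣ (u i) (v i))
          (subst (∣ u i ∣ ℚ.+ ∣ v i ∣ ℚ.<_) (halves ε)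
            (ℚₚ.+-mono-< (u< i (ℕₚ.m⊔n≤o⇒m≤o M N M⊔N≤i))
                         (v< i (ℕₚ.m⊔n≤o⇒n≤o M N M⊔N≤i))))

  record EventuallyBounded {I : Set} (level : I → ℕ) (u : I → ℚ) : Set where
    constructor mkBounded
    field
      bound     : ℚ
      bound>0   : 0ℚ ℚ.< bound
      threshold : ℕ
      bounds    : ∀ i → threshold ℕ.≤ level i → ∣ u i ∣ ℚ.≤ bound

  module _ {level : I → ℕ} where

    vanishing-* : ∀ {u v} → EventuallyBounded level u → Vanishing level v →
                  Vanishing level (λ i → u i ℚ.* v i)
    vanishing-* {u} {v} (mkBounded B 0<B M u≤B) v→0 = mkVanishing λ ε 0<ε →
        combine ε (eventually v→0 (1/B ℚ.* ε) (0<ε/B 0<ε))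
      where
      instance
        B-pos : ℚ.Positive B
        B-pos = ℚ.positive 0<B

        B-nonZero : ℚ.NonZero B
        B-nonZero = ℚₚ.pos⇒nonZero B

      1/B : ℚ
      1/B = ℚ.1/ B

      0<ε/B : ∀ {ε} → 0ℚ ℚ.< ε → 0ℚ ℚ.< 1/B ℚ.* ε
      0<ε/B {ε} 0<ε = subst (ℚ._< 1/B ℚ.* ε) (ℚₚ.*-zeroʳ 1/B)
        (ℚₚ.*-monoʳ-<-pos 1/B {{ℚₚ.1/pos⇒pos B}} 0<ε)

      B*ε/B : ∀ ε → B ℚ.* (1/B ℚ.* ε) ≡ ε
      B*ε/B ε = trans (sym (ℚₚ.*-assoc B 1/B ε))
        (trans (cong (ℚ._* ε) (ℚₚ.*-inverseʳ B)) (ℚₚ.*-identityˡ ε))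

      combine : ∀ ε →
                (∃ λ N → ∀ i → N ℕ.≤ level i → ∣ v i ∣ ℚ.< 1/B ℚ.* ε) →
                ∃ λ N → ∀ i → N ℕ.≤ level i → ∣ u i ℚ.* v i ∣ ℚ.< ε
      combine ε (N , v<) = M ℕ.⊔ N , λ i M⊔N≤i →
        subst (ℚ._< ε) (sym (ℚₚ.∣p*q∣≡∣p∣*∣q∣ (u i) (v i)))
          (ℚₚ.≤-<-trans
            (ℚₚ.*-monoʳ-≤-nonNeg ∣ v i ∣ {{ℚₚ.∣-∣-nonNeg (v i)}}
              (u≤B i (ℕₚ.m⊔n≤o⇒m≤o M N M⊔N≤i)))
            (subst (B ℚ.* ∣ v i ∣ ℚ.<_) (B*ε/B ε)
              (ℚₚ.*-monoʳ-<-pos B (v< i (ℕₚ.m⊔n≤o⇒n≤o M N M⊔N≤i)))))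

  0<1 : 0ℚ ℚ.< 1ℚ
  0<1 = ℚₚ.positive⁻¹ 1ℚ

  bounded : ∀ x → EventuallyBounded (λ n → n) (seq x)
  bounded x =
    let N , close = eventually (cauchy x) 1ℚ 0<1 in
    mkBounded (1ℚ ℚ.+ ∣ seq x N ∣)
      (ℚₚ.+-mono-<-≤ 0<1 (ℚₚ.0≤∣p∣ (seq x N)))
      N
      λ n N≤n →
        subst (λ q → ∣ q ∣ ℚ.≤ 1ℚ ℚ.+ ∣ seq x N ∣) (split (seq x n) (seq x N))
          (ℚₚ.≤-trans (ℚₚ.∣p+q∣≤∣p∣+∣q∣ (seq x n ℚ.- seq x N) (seq x N))
            (ℚₚ.+-monoˡ-≤ ∣ seq x N ∣
              (ℚₚ.<⇒≤ (close (n , N) (ℕₚ.⊓-glb N≤n ℕₚ.≤-refl)))))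
    where
    open +-*-Solver
    split : ∀ a b → (a ℚ.- b) ℚ.+ b ≡ a
    split = solve 2 (λ a b → (a :- b) :+ b := a) refl

  bounded-∘ : ∀ x (level : I → ℕ) (f : I → ℕ) → (∀ i → level i ℕ.≤ f i) →
              EventuallyBounded level (λ i → seq x (f i))
  bounded-∘ x level f level≤f =
    let mkBounded B 0<B N x≤B = bounded x in
    mkBounded B 0<B N λ i N≤i → x≤B (f i) (ℕₚ.≤-trans N≤i (level≤f i))

  module _ where
    open +-*-Solver

    +-diff : ∀ a b c d →
             (a ℚ.- b) ℚ.+ (c ℚ.- d) ≡ (a ℚ.+ c) ℚ.- (b ℚ.+ d)
    +-diff = solve 4 (λ a b c d →
      (a :- b) :+ (c :- d) := (a :+ c) :- (b :+ d)) refl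

    neg-diff : ∀ a b → ℚ.- (a ℚ.- b) ≡ (ℚ.- a) ℚ.- (ℚ.- b)
    neg-diff = solve 2 (λ a b → :- (a :- b) := (:- a) :- (:- b)) refl

    *-diff : ∀ a b c d →
             a ℚ.* (c ℚ.- d) ℚ.+ d ℚ.* (a ℚ.- b) ≡ a ℚ.* c ℚ.- b ℚ.* d
    *-diff = solve 4 (λ a b c d →
      a :* (c :- d) :+ d :* (a :- b) := a :* c :- b :* d) refl

    swap-diff : ∀ a b → ℚ.- (a ℚ.- b) ≡ b ℚ.- a
    swap-diff = solve 2 (λ a b → :- (a :- b) := b :- a) refl

    chain-diff : ∀ a b c → (a ℚ.- b) ℚ.+ (b ℚ.- c) ≡ a ℚ.- c
    chain-diff = solve 3 (λ a b c → (a :- b) :+ (b :- c) := a :- c) refl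

ofℚᴿ : ℚ → ℝ
ofℚᴿ q = mkℝ (λ _ → q)
  (vanishing-cong (λ _ → sym (ℚₚ.+-inverseʳ q)) vanishing-0)

infixl 6 _+ᴿ_ _-ᴿ_
infixl 7 _*ᴿ_
infix  8 -ᴿ_

-- Opaque, so that the type checker never unfolds real arithmetic to ℚ.
opaque
  _+ᴿ_ : ℝ → ℝ → ℝ
  x +ᴿ y = mkℝ (λ n → seq x n ℚ.+ seq y n)
    (vanishing-cong
      (λ (m , n) → +-diff (seq x m) (seq x n) (seq y m) (seq y n))
      (vanishing-+ (cauchy x) (cauchy y)))

  -ᴿ_ : ℝ → ℝ
  -ᴿ x = mkℝ (λ n → ℚ.- seq x n)
    (vanishing-cong (λ (m , n) → neg-diff (seq x m) (seq x n))
      (vanishing-neg (cauchy x)))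

  _*ᴿ_ : ℝ → ℝ → ℝ
  x *ᴿ y = mkℝ (λ n → seq x n ℚ.* seq y n)
    (vanishing-cong
      (λ (m , n) → *-diff (seq x m) (seq x n) (seq y m) (seq y n))
      (vanishing-+
        (vanishing-* (bounded-∘ x _ _ λ (m , n) → ℕₚ.m⊓n≤m m n) (cauchy y))
        (vanishing-* (bounded-∘ y _ _ λ (m , n) → ℕₚ.m⊓n≤n m n) (cauchy x))))

_-ᴿ_ : ℝ → ℝ → ℝ
x -ᴿ y = x +ᴿ (-ᴿ y)

pointwise⇒≈ᴿ : ∀ {x y} → (∀ n → seq x n ≡ seq y n) → x ≈ᴿ y
pointwise⇒≈ᴿ {x} {y} x≡y = mk≈ᴿ (vanishing-cong
  (λ n → sym (trans (cong (ℚ._- seq y n) (x≡y n)) (ℚₚ.+-inverseʳ (seq y n))))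
  vanishing-0)

≈ᴿ-refl : ∀ {x} → x ≈ᴿ x
≈ᴿ-refl = pointwise⇒≈ᴿ λ _ → refl

≈ᴿ-sym : ∀ {x y} → x ≈ᴿ y → y ≈ᴿ x
≈ᴿ-sym {x} {y} (mk≈ᴿ p) = mk≈ᴿ
  (vanishing-cong (λ n → swap-diff (seq x n) (seq y n)) (vanishing-neg p))

≈ᴿ-trans : ∀ {x y z} → x ≈ᴿ y → y ≈ᴿ z → x ≈ᴿ z
≈ᴿ-trans {x} {y} {z} (mk≈ᴿ p) (mk≈ᴿ q) = mk≈ᴿ
  (vanishing-cong (λ n → chain-diff (seq x n) (seq y n) (seq z n))
    (vanishing-+ p q))

opaque
  unfolding _+ᴿ_ -ᴿ_ _*ᴿ_

  +ᴿ-cong : ∀ {x x′ y y′} → x ≈ᴿ x′ → y ≈ᴿ y′ → x +ᴿ y ≈ᴿ x′ +ᴿ y′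
  +ᴿ-cong {x} {x′} {y} {y′} (mk≈ᴿ p) (mk≈ᴿ q) = mk≈ᴿ
    (vanishing-cong (λ n → +-diff (seq x n) (seq x′ n) (seq y n) (seq y′ n))
      (vanishing-+ p q))

  -ᴿ-cong : ∀ {x x′} → x ≈ᴿ x′ → -ᴿ x ≈ᴿ -ᴿ x′
  -ᴿ-cong {x} {x′} (mk≈ᴿ p) = mk≈ᴿ
    (vanishing-cong (λ n → neg-diff (seq x n) (seq x′ n)) (vanishing-neg p))

  *ᴿ-cong : ∀ {x x′ y y′} → x ≈ᴿ x′ → y ≈ᴿ y′ → x *ᴿ y ≈ᴿ x′ *ᴿ y′
  *ᴿ-cong {x} {x′} {y} {y′} (mk≈ᴿ p) (mk≈ᴿ q) = mk≈ᴿ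
    (vanishing-cong (λ n → *-diff (seq x n) (seq x′ n) (seq y n) (seq y′ n))
      (vanishing-+ (vanishing-* (bounded x) q) (vanishing-* (bounded y′) p)))

  +ᴿ-assoc : ∀ x y z → (x +ᴿ y) +ᴿ z ≈ᴿ x +ᴿ (y +ᴿ z)
  +ᴿ-assoc x y z =
    pointwise⇒≈ᴿ λ n → ℚₚ.+-assoc (seq x n) (seq y n) (seq z n)

  +ᴿ-comm : ∀ x y → x +ᴿ y ≈ᴿ y +ᴿ x
  +ᴿ-comm x y = pointwise⇒≈ᴿ λ n → ℚₚ.+-comm (seq x n) (seq y n)

  +ᴿ-identityˡ : ∀ x → ofℚᴿ 0ℚ +ᴿ x ≈ᴿ x
  +ᴿ-identityˡ x = pointwise⇒≈ᴿ λ n → ℚₚ.+-identityˡ (seq x n)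

  -ᴿ-inverseˡ : ∀ x → (-ᴿ x) +ᴿ x ≈ᴿ ofℚᴿ 0ℚ
  -ᴿ-inverseˡ x = pointwise⇒≈ᴿ λ n → ℚₚ.+-inverseˡ (seq x n)

  *ᴿ-assoc : ∀ x y z → (x *ᴿ y) *ᴿ z ≈ᴿ x *ᴿ (y *ᴿ z)
  *ᴿ-assoc x y z =
    pointwise⇒≈ᴿ λ n → ℚₚ.*-assoc (seq x n) (seq y n) (seq z n)

  *ᴿ-comm : ∀ x y → x *ᴿ y ≈ᴿ y *ᴿ x
  *ᴿ-comm x y = pointwise⇒≈ᴿ λ n → ℚₚ.*-comm (seq x n) (seq y n)

  *ᴿ-identityˡ : ∀ x → ofℚᴿ 1ℚ *ᴿ x ≈ᴿ x
  *ᴿ-identityˡ x = pointwise⇒≈ᴿ λ n → ℚₚ.*-identityˡ (seq x n)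

  *ᴿ-distribˡ : ∀ x y z → x *ᴿ (y +ᴿ z) ≈ᴿ x *ᴿ y +ᴿ x *ᴿ z
  *ᴿ-distribˡ x y z =
    pointwise⇒≈ᴿ λ n → ℚₚ.*-distribˡ-+ (seq x n) (seq y n) (seq z n)

  ofℚᴿ-+ : ∀ p q → ofℚᴿ (p ℚ.+ q) ≈ᴿ ofℚᴿ p +ᴿ ofℚᴿ q
  ofℚᴿ-+ p q = pointwise⇒≈ᴿ λ _ → refl

  ofℚᴿ-neg : ∀ p → ofℚᴿ (ℚ.- p) ≈ᴿ -ᴿ ofℚᴿ p
  ofℚᴿ-neg p = pointwise⇒≈ᴿ λ _ → refl

  ofℚᴿ-* : ∀ p q → ofℚᴿ (p ℚ.* q) ≈ᴿ ofℚᴿ p *ᴿ ofℚᴿ q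
  ofℚᴿ-* p q = pointwise⇒≈ᴿ λ _ → refl

ℝ-commutativeRing : CommutativeRing 0ℓ 0ℓ
ℝ-commutativeRing = record
  { Carrier = ℝ
  ; _≈_ = _≈ᴿ_
  ; _+_ = _+ᴿ_
  ; _*_ = _*ᴿ_
  ; -_ = -ᴿ_
  ; 0# = ofℚᴿ 0ℚ
  ; 1# = ofℚᴿ 1ℚ
  ; isCommutativeRing = record
    { isRing = record
      { +-isAbelianGroup = record
        { isGroup = record
          { isMonoid = record
            { isSemigroup = record
              { isMagma = record
                { isEquivalence = isEquivalence
                ; ∙-cong = +ᴿ-cong
                }
              ; assoc = +ᴿ-assoc
              }
            ; identity = comm∧idˡ⇒id +ᴿ-comm +ᴿ-identityˡ
            }
          ; inverse = comm∧invˡ⇒inv +ᴿ-comm -ᴿ-inverseˡ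
          ; ⁻¹-cong = -ᴿ-cong
          }
        ; comm = +ᴿ-comm
        }
      ; *-cong = *ᴿ-cong
      ; *-assoc = *ᴿ-assoc
      ; *-identity = comm∧idˡ⇒id *ᴿ-comm *ᴿ-identityˡ
      ; distrib = comm∧distrˡ⇒distr +ᴿ-cong *ᴿ-comm *ᴿ-distribˡ
      }
    ; *-comm = *ᴿ-comm
    }
  }
  where
  isEquivalence : IsEquivalence _≈ᴿ_
  isEquivalence = record { refl = ≈ᴿ-refl ; sym = ≈ᴿ-sym ; trans = ≈ᴿ-trans }

  ≈ᴿ-setoid : Setoid 0ℓ 0ℓ
  ≈ᴿ-setoid = record { isEquivalence = isEquivalence }

  open Consequences ≈ᴿ-setoid

private
  ofℚᴿ-morphism :
    CommutativeRing.rawRing ℚₚ.+-*-commutativeRing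
      -Raw-AlmostCommutative⟶ fromCommutativeRing ℝ-commutativeRing
  ofℚᴿ-morphism = record
    { ⟦_⟧ = ofℚᴿ
    ; +-homo = ofℚᴿ-+
    ; *-homo = ofℚᴿ-*
    ; -‿homo = ofℚᴿ-neg
    ; 0-homo = ≈ᴿ-refl
    ; 1-homo = ≈ᴿ-refl
    }

  ofℚᴿ-cong : ∀ {p q} → p ≡ q → ofℚᴿ p ≈ᴿ ofℚᴿ q
  ofℚᴿ-cong refl = ≈ᴿ-refl

  ofℚᴿ-≟ : ∀ p q → Maybe (ofℚᴿ p ≈ᴿ ofℚᴿ q)
  ofℚᴿ-≟ p q = Maybe.map ofℚᴿ-cong (dec⇒maybe (p ℚₚ.≟ q))

  module ℝ-Solver = RingSolver
    (CommutativeRing.rawRing ℚₚ.+-*-commutativeRing)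
    (fromCommutativeRing ℝ-commutativeRing)
    ofℚᴿ-morphism ofℚᴿ-≟

infix 5 _+i_

record ℂ : Set where
  constructor _+i_
  field
    re im : ℝ

open ℂ public

infix 4 _≈ᶜ_

record _≈ᶜ_ (z w : ℂ) : Set where
  constructor mk≈ᶜ
  field
    re≈ : re z ≈ᴿ re w
    im≈ : im z ≈ᴿ im w

open _≈ᶜ_ public

infixl 6 _+ᶜ_
infixl 7 _*ᶜ_
infix  8 -ᶜ_

_+ᶜ_ : ℂ → ℂ → ℂ
z +ᶜ w = (re z +ᴿ re w) +i (im z +ᴿ im w)

-ᶜ_ : ℂ → ℂ
-ᶜ z = (-ᴿ re z) +i (-ᴿ im z)

_*ᶜ_ : ℂ → ℂ → ℂ
z *ᶜ w = (re z *ᴿ re w -ᴿ im z *ᴿ im w) +i (re z *ᴿ im w +ᴿ im z *ᴿ re w)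

ofℚ : ℚ → ℂ
ofℚ q = ofℚᴿ q +i ofℚᴿ 0ℚ

ℂ-commutativeRing : CommutativeRing 0ℓ 0ℓ
ℂ-commutativeRing = record
  { Carrier = ℂ
  ; _≈_ = _≈ᶜ_
  ; _+_ = _+ᶜ_
  ; _*_ = _*ᶜ_
  ; -_ = -ᶜ_
  ; 0# = ofℚ 0ℚ
  ; 1# = ofℚ 1ℚ
  ; isCommutativeRing = record
    { isRing = record
      { +-isAbelianGroup = record
        { isGroup = record
          { isMonoid = record
            { isSemigroup = record
              { isMagma = record
                { isEquivalence = isEquivalence
                ; ∙-cong = +ᶜ-cong
                }
              ; assoc = λ _ _ _ → mk≈ᶜ (+ᴿ-assoc _ _ _) (+ᴿ-assoc _ _ _)
              }
            ; identity = comm∧idˡ⇒id +ᶜ-comm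
                (λ _ → mk≈ᶜ (+ᴿ-identityˡ _) (+ᴿ-identityˡ _))
            }
          ; inverse = comm∧invˡ⇒inv +ᶜ-comm
              (λ _ → mk≈ᶜ (-ᴿ-inverseˡ _) (-ᴿ-inverseˡ _))
          ; ⁻¹-cong = λ p → mk≈ᶜ (-ᴿ-cong (re≈ p)) (-ᴿ-cong (im≈ p))
          }
        ; comm = +ᶜ-comm
        }
      ; *-cong = λ p q → mk≈ᶜ
          (+ᴿ-cong (*ᴿ-cong (re≈ p) (re≈ q)) (-ᴿ-cong (*ᴿ-cong (im≈ p) (im≈ q))))
          (+ᴿ-cong (*ᴿ-cong (re≈ p) (im≈ q)) (*ᴿ-cong (im≈ p) (re≈ q)))
      ; *-assoc = *ᶜ-assoc
      ; *-identity = comm∧idˡ⇒id *ᶜ-comm *ᶜ-identityˡ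
      ; distrib = comm∧distrˡ⇒distr +ᶜ-cong *ᶜ-comm *ᶜ-distribˡ
      }
    ; *-comm = *ᶜ-comm
    }
  }
  where
  isEquivalence : IsEquivalence _≈ᶜ_
  isEquivalence = record
    { refl  = mk≈ᶜ ≈ᴿ-refl ≈ᴿ-refl
    ; sym   = λ p → mk≈ᶜ (≈ᴿ-sym (re≈ p)) (≈ᴿ-sym (im≈ p))
    ; trans = λ p q → mk≈ᶜ (≈ᴿ-trans (re≈ p) (re≈ q)) (≈ᴿ-trans (im≈ p) (im≈ q))
    }

  ≈ᶜ-setoid : Setoid 0ℓ 0ℓ
  ≈ᶜ-setoid = record { isEquivalence = isEquivalence }

  open Consequences ≈ᶜ-setoid
  open ℝ-Solver

  +ᶜ-cong : ∀ {z z′ w w′} → z ≈ᶜ z′ → w ≈ᶜ w′ → z +ᶜ w ≈ᶜ z′ +ᶜ w′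
  +ᶜ-cong p q = mk≈ᶜ (+ᴿ-cong (re≈ p) (re≈ q)) (+ᴿ-cong (im≈ p) (im≈ q))

  +ᶜ-comm : ∀ z w → z +ᶜ w ≈ᶜ w +ᶜ z
  +ᶜ-comm _ _ = mk≈ᶜ (+ᴿ-comm _ _) (+ᴿ-comm _ _)

  *ᶜ-assoc : ∀ z w v → (z *ᶜ w) *ᶜ v ≈ᶜ z *ᶜ (w *ᶜ v)
  *ᶜ-assoc (a +i b) (c +i d) (e +i f) = mk≈ᶜ
    (solve 6 (λ a b c d e f →
      (a :* c :- b :* d) :* e :- (a :* d :+ b :* c) :* f
      := a :* (c :* e :- d :* f) :- b :* (c :* f :+ d :* e))
      ≈ᴿ-refl a b c d e f)
    (solve 6 (λ a b c d e f →
      (a :* c :- b :* d) :* f :+ (a :* d :+ b :* c) :* e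
      := a :* (c :* f :+ d :* e) :+ b :* (c :* e :- d :* f))
      ≈ᴿ-refl a b c d e f)

  *ᶜ-comm : ∀ z w → z *ᶜ w ≈ᶜ w *ᶜ z
  *ᶜ-comm (a +i b) (c +i d) = mk≈ᶜ
    (solve 4 (λ a b c d → a :* c :- b :* d := c :* a :- d :* b)
      ≈ᴿ-refl a b c d)
    (solve 4 (λ a b c d → a :* d :+ b :* c := c :* b :+ d :* a)
      ≈ᴿ-refl a b c d)

  *ᶜ-identityˡ : ∀ z → ofℚ 1ℚ *ᶜ z ≈ᶜ z
  *ᶜ-identityˡ (a +i b) = mk≈ᶜ
    (solve 2 (λ a b → con 1ℚ :* a :- con 0ℚ :* b := a) ≈ᴿ-refl a b)
    (solve 2 (λ a b → con 1ℚ :* b :+ con 0ℚ :* a := b) ≈ᴿ-refl a b)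

  *ᶜ-distribˡ : ∀ z w v → z *ᶜ (w +ᶜ v) ≈ᶜ z *ᶜ w +ᶜ z *ᶜ v
  *ᶜ-distribˡ (a +i b) (c +i d) (e +i f) = mk≈ᶜ
    (solve 6 (λ a b c d e f →
      a :* (c :+ e) :- b :* (d :+ f)
      := (a :* c :- b :* d) :+ (a :* e :- b :* f))
      ≈ᴿ-refl a b c d e f)
    (solve 6 (λ a b c d e f →
      a :* (d :+ f) :+ b :* (c :+ e)
      := (a :* d :+ b :* c) :+ (a :* f :+ b :* e))
      ≈ᴿ-refl a b c d e f)

module Polynomials {c ℓ} (R : CommutativeRing c ℓ) where

  open CommutativeRing R
  open RawMonoidDefs +-rawMonoid using () renaming (_×_ to _×ᴿ_)

  -- Coefficients in order of increasing degree; zeros at the end are allowed.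
  Poly : Set c
  Poly = List Carrier

  coeff : Poly → ℕ → Carrier
  coeff []      _       = 0#
  coeff (a ∷ p) zero    = a
  coeff (a ∷ p) (suc n) = coeff p n

  infix 4 _≈ᵖ_

  _≈ᵖ_ : Poly → Poly → Set ℓ
  p ≈ᵖ q = ∀ n → coeff p n ≈ coeff q n

  HasDegree : Poly → ℕ → Set ℓ
  HasDegree p d = ¬ (coeff p d ≈ 0#) × (∀ n → d ℕ.< n → coeff p n ≈ 0#)

  eval : Poly → Carrier → Carrier
  eval []      x = 0#
  eval (a ∷ p) x = a + x * eval p x

  infixl 6 _+ᵖ_ _-ᵖ_
  infixl 7 _*ᵖ_ _·ᵖ_
  infix  8 -ᵖ_

  _+ᵖ_ : Poly → Poly → Poly
  []      +ᵖ q       = q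
  (a ∷ p) +ᵖ []      = a ∷ p
  (a ∷ p) +ᵖ (b ∷ q) = (a + b) ∷ (p +ᵖ q)

  -ᵖ_ : Poly → Poly
  -ᵖ_ = map (-_)

  _-ᵖ_ : Poly → Poly → Poly
  p -ᵖ q = p +ᵖ (-ᵖ q)

  _·ᵖ_ : Carrier → Poly → Poly
  a ·ᵖ p = map (a *_) p

  _*ᵖ_ : Poly → Poly → Poly
  []      *ᵖ q = []
  (a ∷ p) *ᵖ q = (a ·ᵖ q) +ᵖ (0# ∷ (p *ᵖ q))

  0ᵖ 1ᵖ X : Poly
  0ᵖ = []
  1ᵖ = 1# ∷ []
  X  = 0# ∷ 1# ∷ []

  ofℕᵖ : ℕ → Poly
  ofℕᵖ m = (m ×ᴿ 1#) ∷ []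

  +ᵖ-rawMonoid : RawMonoid c ℓ
  +ᵖ-rawMonoid = record
    { Carrier = Poly ; _≈_ = _≈ᵖ_ ; _∙_ = _+ᵖ_ ; ε = 0ᵖ }

  fallingFactorial : Poly → ℕ → Poly
  fallingFactorial q zero    = 1ᵖ
  fallingFactorial q (suc k) = fallingFactorial q k *ᵖ (q -ᵖ ofℕᵖ k)

open CommutativeRing ℂ-commutativeRing public
  using (_≈_; _+_; _*_; -_; 0#; 1#; +-rawMonoid)
open Polynomials ℂ-commutativeRing public
open RawMonoidDefs +-rawMonoid public using (sum) renaming (_×_ to _×ᶜ_)
open RawMonoidDefs +ᵖ-rawMonoid public using () renaming (sum to sumᵖ)

ofℕ : ℕ → ℂ
ofℕ m = m ×ᶜ 1#

1/_! : ℕ → ℂ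
1/ n ! = ofℚ ((ℤ.+ 1 ℚ./ n !) {{ℕₚ._!≢0 n}})

binomial : Poly → ℕ → Poly
binomial q n = 1/ n ! ·ᵖ fallingFactorial q n

-- Only the values S n k and A n k with k ≤ n matter below. The polynomials in
-- each expansion are linearly independent, so these values are determined by p.

IsStirling₂ : (ℕ → Poly) → (ℕ → ℕ → ℂ) → Set
IsStirling₂ p S = ∀ n →
  p n ≈ᵖ sumᵖ {suc n} (λ k → S n (toℕ k) ·ᵖ fallingFactorial X (toℕ k))

-- The argument x + n - k - 1 is formed in ℂ[x]: for k = n it is x - 1.
IsEulerian : (ℕ → Poly) → (ℕ → ℕ → ℂ) → Set
IsEulerian p A = ∀ n →
  p n ≈ᵖ sumᵖ {suc n} (λ k →
    A n (toℕ k) ·ᵖ binomial (X +ᵖ ofℕᵖ n -ᵖ ofℕᵖ (toℕ k) -ᵖ ofℕᵖ 1) n)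

{-# OPTIONS --safe #-}

-- Both expansions are compared at the natural numbers m. There the Stirling
-- expansion reads Σₖ k! S₂(n,k) C(m,k), and the Eulerian one Σⱼ A(n,j-1) C(m+n-j,n),
-- where the term of A(n,n) is absent: at m = 0 it is ±A(n,n), and all the others
-- vanish. Vandermonde's identity C(m+n-j,n) = Σₖ C(m,k) C(n-j,n-k) turns the latter
-- into an expansion in the C(m,k) too, and such expansions are unique.

module Submission where

open import Algebra.Bundles using (CommutativeRing)
import Algebra.Properties.CommutativeSemigroup as CommutativeSemigroupProperties
import Algebra.Properties.Ring as RingProperties
import Algebra.Properties.Semiring.Mult as Mult
import Algebra.Properties.Semiring.Sum as Sum
open import Data.Fin.Base using (Fin; zero; suc; toℕ)
open import Data.Fin.Properties using (toℕ<n)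
import Data.Integer.Base as ℤ
import Data.Integer.Solver as ℤSolver
open import Data.List.Base using ([]; _∷_)
open import Data.Nat.Base as ℕ using (ℕ; zero; suc; _≤_; _<_; _∸_; _!; z≤n; s≤s; s<s)
open import Data.Nat.Combinatorics
  using (_C_; k>n⇒nCk≡0; nC1≡n; nCk≡nC[n∸k]; nCn≡1; nCk+nC[k+1]≡[n+1]C[k+1])
open import Data.Nat.Induction using (<-rec)
import Data.Nat.Properties as ℕₚ
import Data.Nat.Solver as ℕSolver
open import Data.Rational.Base as ℚ using (0ℚ; 1ℚ)
import Data.Rational.Properties as ℚₚ
import Data.Rational.Unnormalised.Base as ℚᵘ
import Data.Rational.Unnormalised.Properties as ℚᵘₚ
import Relation.Binary.PropositionalEquality as ≡
open ≡ using (_≡_)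
import Relation.Binary.Reasoning.Setoid as SetoidReasoning

open import Defs using (module Polynomials)

-- Binomial coefficients of natural numbers.

nC0≡1 : ∀ n → n C 0 ≡ 1
nC0≡1 n = ≡.trans (nCk≡nC[n∸k] {n = n} z≤n) (nCn≡1 n)

-- A subtraction-free form of (k+1) C(n,k+1) = (n-k) C(n,k), valid also for k > n. It drives the
-- recurrence of falling factorials at natural numbers. The proof is by induction on n through
-- Pascal's rule.
[k+1]nC[k+1]+knCk≡n[nCk] : ∀ n k →
  suc k ℕ.* (n C suc k) ℕ.+ k ℕ.* (n C k) ≡ n ℕ.* (n C k)
[k+1]nC[k+1]+knCk≡n[nCk] zero zero = ≡.refl
[k+1]nC[k+1]+knCk≡n[nCk] zero (suc k) =
  ≡.cong₂ ℕ._+_ (ℕₚ.*-zeroʳ (suc (suc k))) (ℕₚ.*-zeroʳ (suc k))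
[k+1]nC[k+1]+knCk≡n[nCk] (suc n) zero
  rewrite nC1≡n (suc n) | nC0≡1 (suc n) = solve 1 (λ n →
    (con 1 :+ n) :+ con 0 :+ con 0 := (con 1 :+ n) :* con 1) ≡.refl n
  where open ℕSolver.+-*-Solver
[k+1]nC[k+1]+knCk≡n[nCk] (suc n) (suc k)
  rewrite ≡.sym (nCk+nC[k+1]≡[n+1]C[k+1] n k)
        | ≡.sym (nCk+nC[k+1]≡[n+1]C[k+1] n (suc k)) = begin
  (2 ℕ.+ k) ℕ.* (b ℕ.+ c) ℕ.+ (1 ℕ.+ k) ℕ.* (a ℕ.+ b)
    -- The regrouping exposes the left-hand sides of the induction hypothesis at k+1 and at k.
    ≡⟨ solve 4 (λ k a b c →
         (con 2 :+ k) :* (b :+ c) :+ (con 1 :+ k) :* (a :+ b) :=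
         (((con 2 :+ k) :* c :+ (con 1 :+ k) :* b) :+
          ((con 1 :+ k) :* b :+ k :* a)) :+ (a :+ b)) ≡.refl k a b c ⟩
  (((2 ℕ.+ k) ℕ.* c ℕ.+ (1 ℕ.+ k) ℕ.* b) ℕ.+
   ((1 ℕ.+ k) ℕ.* b ℕ.+ k ℕ.* a)) ℕ.+ (a ℕ.+ b)
    ≡⟨ ≡.cong (ℕ._+ (a ℕ.+ b)) (≡.cong₂ ℕ._+_
         ([k+1]nC[k+1]+knCk≡n[nCk] n (suc k)) ([k+1]nC[k+1]+knCk≡n[nCk] n k)) ⟩
  (n ℕ.* b ℕ.+ n ℕ.* a) ℕ.+ (a ℕ.+ b)
    ≡⟨ solve 3 (λ n a b →
         (n :* b :+ n :* a) :+ (a :+ b) := (con 1 :+ n) :* (a :+ b)) ≡.refl n a b ⟩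
  suc n ℕ.* (a ℕ.+ b) ∎
  where
  open ≡.≡-Reasoning
  open ℕSolver.+-*-Solver
  a b c : ℕ
  a = n C k
  b = n C suc k
  c = n C suc (suc k)

module ℕSum = Sum ℕₚ.+-*-semiring

-- Induction on m: Pascal's rule, applied to every term but the first, splits the sum for (m+1, k+1)
-- into those for (m, k) and (m, k+1).
vandermonde : ∀ m n k →
  ℕSum.sum {suc k} (λ i → (m C toℕ i) ℕ.* (n C (k ∸ toℕ i))) ≡ (m ℕ.+ n) C k
vandermonde zero n k = begin
  1 ℕ.* (n C k) ℕ.+ ℕSum.sum {k} (λ i → 0 ℕ.* (n C (k ∸ suc (toℕ i))))
    ≡⟨ ≡.cong₂ ℕ._+_ (ℕₚ.*-identityˡ (n C k)) (ℕSum.sum-replicate-zero k) ⟩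
  n C k ℕ.+ 0
    ≡⟨ ℕₚ.+-identityʳ (n C k) ⟩
  n C k ∎
  where open ≡.≡-Reasoning
vandermonde (suc m) n zero
  rewrite nC0≡1 (suc m) | nC0≡1 n | nC0≡1 (suc m ℕ.+ n) = ≡.refl
vandermonde (suc m) n (suc k) = begin
  (suc m C 0) ℕ.* (n C suc k) ℕ.+ ℕSum.sum {suc k} (λ i → (suc m C suc (toℕ i)) ℕ.* c i)
    ≡⟨ ≡.cong₂ ℕ._+_
         (≡.cong (ℕ._* (n C suc k)) (≡.trans (nC0≡1 (suc m)) (≡.sym (nC0≡1 m))))
         (ℕSum.sum-cong-≗ {suc k} pascal) ⟩
  (m C 0) ℕ.* (n C suc k) ℕ.+ ℕSum.sum {suc k} (λ i → a i ℕ.+ b i)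
    ≡⟨ ≡.cong ((m C 0) ℕ.* (n C suc k) ℕ.+_) (ℕSum.∑-distrib-+ a b) ⟩
  (m C 0) ℕ.* (n C suc k) ℕ.+ (ℕSum.sum a ℕ.+ ℕSum.sum b)
    -- The term of index 0 joins `b`, whose indices are shifted by one; together they form the full
    -- sum for k+1.
    ≡⟨ x∙yz≈y∙xz ((m C 0) ℕ.* (n C suc k)) (ℕSum.sum a) (ℕSum.sum b) ⟩
  ℕSum.sum a ℕ.+ ((m C 0) ℕ.* (n C suc k) ℕ.+ ℕSum.sum b)
    ≡⟨ ≡.cong₂ ℕ._+_ (vandermonde m n k) (vandermonde m n (suc k)) ⟩
  (m ℕ.+ n) C k ℕ.+ (m ℕ.+ n) C suc k
    ≡⟨ nCk+nC[k+1]≡[n+1]C[k+1] (m ℕ.+ n) k ⟩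
  suc (m ℕ.+ n) C suc k ∎
  where
  open ≡.≡-Reasoning
  open CommutativeSemigroupProperties ℕₚ.+-commutativeSemigroup using (x∙yz≈y∙xz)
  a b c : Fin (suc k) → ℕ
  c i = n C (k ∸ toℕ i)
  a i = (m C toℕ i) ℕ.* c i
  b i = (m C suc (toℕ i)) ℕ.* c i

  pascal : ∀ i → (suc m C suc (toℕ i)) ℕ.* c i ≡ a i ℕ.+ b i
  pascal i = ≡.trans
    (≡.cong (ℕ._* c i) (≡.sym (nCk+nC[k+1]≡[n+1]C[k+1] m (toℕ i))))
    (ℕₚ.*-distribʳ-+ (c i) (m C toℕ i) (m C suc (toℕ i)))

-- The comparison takes place over any commutative ring; inverses of the factorials enter as a
-- parameter of the inner module.
module RingExpansions {c ℓ} (R : CommutativeRing c ℓ) where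

  open CommutativeRing R hiding (zero)
  open Polynomials R
  open RingProperties ring
    using ( -0#≈0#; -‿+-comm; -‿distribʳ-*; -‿involutive
          ; +-cancelˡ; //-rightDividesʳ)
  open CommutativeSemigroupProperties +-commutativeSemigroup using (interchange)
  open CommutativeSemigroupProperties *-commutativeSemigroup
    using (x∙yz≈y∙xz; x∙yz≈xz∙y)
  open Mult semiring using (_×_; ×-congˡ; ×-homo-1; ×-homo-+; ×1-homo-*)
  open Sum semiring
  open import Algebra.Definitions.RawMonoid +ᵖ-rawMonoid using () renaming (sum to sumᵖ)
  open SetoidReasoning setoid

  -- Natural numbers in the ring, and finite sums.

  ι : ℕ → Carrier
  ι m = m × 1#

  ι-cong : ∀ {m n} → m ≡ n → ι m ≈ ι n
  ι-cong = ×-congˡ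

  ι-+ : ∀ m n → ι (m ℕ.+ n) ≈ ι m + ι n
  ι-+ = ×-homo-+ 1#

  ι-sum : ∀ {n} (f : Fin n → ℕ) → ι (ℕSum.sum f) ≈ sum (λ i → ι (f i))
  ι-sum {zero}  f = refl
  ι-sum {suc n} f = trans (ι-+ (f zero) _) (+-congˡ (ι-sum (λ i → f (suc i))))

  -- The summand is a function on ℕ rather than on `Fin n`, so that the same function can be summed
  -- over ranges of different length.
  sum-truncate : ∀ {k n} (f : ℕ → Carrier) → k ≤ n →
                 (∀ i → k ≤ i → i < n → f i ≈ 0#) →
                 sum {n} (λ i → f (toℕ i)) ≈ sum {k} (λ i → f (toℕ i))
  sum-truncate {n = n} f z≤n f≈0 = trans
    (sum-cong-≋ {n} (λ i → f≈0 (toℕ i) z≤n (toℕ<n i))) (sum-replicate-zero n)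
  sum-truncate f (s≤s k≤n) f≈0 = +-congˡ (sum-truncate (λ i → f (suc i)) k≤n
    (λ i k≤i i<n → f≈0 (suc i) (s≤s k≤i) (s<s i<n)))

  sum-last : ∀ n (f : ℕ → Carrier) →
             sum {suc n} (λ i → f (toℕ i)) ≈ sum {n} (λ i → f (toℕ i)) + f n
  sum-last zero    f = +-comm (f 0) 0#
  sum-last (suc n) f = trans (+-congˡ (sum-last n (λ i → f (suc i)))) (sym (+-assoc _ _ _))

  sum-cong-< : ∀ {n} (f g : ℕ → Carrier) → (∀ i → i < n → f i ≈ g i) →
               sum {n} (λ i → f (toℕ i)) ≈ sum {n} (λ i → g (toℕ i))
  sum-cong-< {n} f g f≈g = sum-cong-≋ {n} (λ i → f≈g (toℕ i) (toℕ<n i))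

  -- Evaluation as a ring homomorphism.

  eval-0 : ∀ p x → p ≈ᵖ 0ᵖ → eval p x ≈ 0#
  eval-0 []      x p≈0 = refl
  eval-0 (a ∷ p) x p≈0 = begin
    a + x * eval p x  ≈⟨ +-cong (p≈0 0) (*-congˡ (eval-0 p x (λ n → p≈0 (suc n)))) ⟩
    0# + x * 0#       ≈⟨ trans (+-identityˡ _) (zeroʳ x) ⟩
    0#                ∎

  -- Zeros at the end of a list are allowed, so an empty list may equal a nonempty one; `eval-0`
  -- settles these cases.
  eval-cong : ∀ p q x → p ≈ᵖ q → eval p x ≈ eval q x
  eval-cong []      q       x p≈q = sym (eval-0 q x (λ n → sym (p≈q n)))
  eval-cong (a ∷ p) []      x p≈q = eval-0 (a ∷ p) x p≈q
  eval-cong (a ∷ p) (b ∷ q) x p≈q =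
    +-cong (p≈q 0) (*-congˡ (eval-cong p q x (λ n → p≈q (suc n))))

  eval-+ᵖ : ∀ p q x → eval (p +ᵖ q) x ≈ eval p x + eval q x
  eval-+ᵖ []      q       x = sym (+-identityˡ _)
  eval-+ᵖ (a ∷ p) []      x = sym (+-identityʳ _)
  eval-+ᵖ (a ∷ p) (b ∷ q) x = begin
    (a + b) + x * eval (p +ᵖ q) x             ≈⟨ +-congˡ (*-congˡ (eval-+ᵖ p q x)) ⟩
    (a + b) + x * (eval p x + eval q x)       ≈⟨ +-congˡ (distribˡ x _ _) ⟩
    (a + b) + (x * eval p x + x * eval q x)   ≈⟨ interchange a b _ _ ⟩
    (a + x * eval p x) + (b + x * eval q x)   ∎

  eval--ᵖ : ∀ p x → eval (-ᵖ p) x ≈ - eval p x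
  eval--ᵖ []      x = sym -0#≈0#
  eval--ᵖ (a ∷ p) x = begin
    - a + x * eval (-ᵖ p) x  ≈⟨ +-congˡ (*-congˡ (eval--ᵖ p x)) ⟩
    - a + x * - eval p x     ≈⟨ +-congˡ (-‿distribʳ-* x _) ⟨
    - a + - (x * eval p x)   ≈⟨ -‿+-comm a _ ⟩
    - (a + x * eval p x)     ∎

  eval-·ᵖ : ∀ a p x → eval (a ·ᵖ p) x ≈ a * eval p x
  eval-·ᵖ a []      x = sym (zeroʳ a)
  eval-·ᵖ a (b ∷ p) x = begin
    a * b + x * eval (a ·ᵖ p) x   ≈⟨ +-congˡ (*-congˡ (eval-·ᵖ a p x)) ⟩
    a * b + x * (a * eval p x)    ≈⟨ +-congˡ (x∙yz≈y∙xz x a _) ⟩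
    a * b + a * (x * eval p x)    ≈⟨ distribˡ a b _ ⟨
    a * (b + x * eval p x)        ∎

  eval-*ᵖ : ∀ p q x → eval (p *ᵖ q) x ≈ eval p x * eval q x
  eval-*ᵖ []      q x = sym (zeroˡ _)
  eval-*ᵖ (a ∷ p) q x = begin
    eval ((a ·ᵖ q) +ᵖ (0# ∷ (p *ᵖ q))) x
      ≈⟨ eval-+ᵖ (a ·ᵖ q) (0# ∷ (p *ᵖ q)) x ⟩
    eval (a ·ᵖ q) x + (0# + x * eval (p *ᵖ q) x)
      ≈⟨ +-cong (eval-·ᵖ a q x) (+-identityˡ _) ⟩
    a * eval q x + x * eval (p *ᵖ q) x
      ≈⟨ +-congˡ (*-congˡ (eval-*ᵖ p q x)) ⟩
    a * eval q x + x * (eval p x * eval q x)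
      ≈⟨ +-congˡ (*-assoc x _ _) ⟨
    a * eval q x + (x * eval p x) * eval q x
      ≈⟨ distribʳ (eval q x) a _ ⟨
    (a + x * eval p x) * eval q x ∎

  eval-constant : ∀ a x → eval (a ∷ []) x ≈ a
  eval-constant a x = trans (+-congˡ (zeroʳ x)) (+-identityʳ a)

  eval-X : ∀ x → eval X x ≈ x
  eval-X x = begin
    0# + x * eval (1# ∷ []) x  ≈⟨ +-identityˡ _ ⟩
    x * eval (1# ∷ []) x       ≈⟨ *-congˡ (eval-constant 1# x) ⟩
    x * 1#                     ≈⟨ *-identityʳ x ⟩
    x                          ∎

  eval--ᵖofℕᵖ : ∀ q m x → eval (q -ᵖ ofℕᵖ m) x ≈ eval q x + - ι m
  eval--ᵖofℕᵖ q m x = trans (eval-+ᵖ q (-ᵖ ofℕᵖ m) x)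
    (+-congˡ (eval-constant (- ι m) x))

  eval-sumᵖ : ∀ {n} (f : Fin n → Poly) x → eval (sumᵖ f) x ≈ sum (λ i → eval (f i) x)
  eval-sumᵖ {zero}  f x = refl
  eval-sumᵖ {suc n} f x = trans (eval-+ᵖ (f zero) _ x)
    (+-congˡ (eval-sumᵖ (λ i → f (suc i)) x))

  -- Values of falling factorials, and uniqueness of binomial expansions.

  eval-fallingFactorial-suc : ∀ q k x →
    eval (fallingFactorial q (suc k)) x ≈
    eval (fallingFactorial q k) x * (eval q x + - ι k)
  eval-fallingFactorial-suc q k x = trans
    (eval-*ᵖ (fallingFactorial q k) _ x) (*-congˡ (eval--ᵖofℕᵖ q k x))

  -- The additive hypothesis avoids truncated subtraction in ℕ, so m < k is covered as well.
  ι-*-difference : ∀ a b m k → b ℕ.+ a ℕ.* k ≡ a ℕ.* m → ι a * (ι m + - ι k) ≈ ι b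
  ι-*-difference a b m k eq = begin
    ι a * (ι m + - ι k)              ≈⟨ distribˡ (ι a) _ _ ⟩
    ι a * ι m + ι a * - ι k          ≈⟨ +-cong (×1-homo-* a m) (-‿distribʳ-* (ι a) (ι k)) ⟨
    ι (a ℕ.* m) + - (ι a * ι k)      ≈⟨ +-congʳ (ι-cong eq) ⟨
    ι (b ℕ.+ a ℕ.* k) + - (ι a * ι k) ≈⟨ +-congʳ (trans (ι-+ b _) (+-congˡ (×1-homo-* a k))) ⟩
    (ι b + ι a * ι k) + - (ι a * ι k) ≈⟨ //-rightDividesʳ (ι a * ι k) (ι b) ⟩
    ι b                              ∎

  -- Induction on k by the absorption identity for binomials. Only the value of `q` at `x` matters,
  -- so the lemma serves both `X` and the shifted Eulerian arguments. For k > m both sides vanish.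
  eval-fallingFactorial-ι : ∀ q x m → eval q x ≈ ι m → ∀ k →
    eval (fallingFactorial q k) x ≈ ι ((m C k) ℕ.* k !)
  eval-fallingFactorial-ι q x m q≈m zero = trans (eval-constant 1# x) (sym (trans
    (ι-cong (≡.cong (ℕ._* 1) (nC0≡1 m))) (×-homo-1 1#)))
  eval-fallingFactorial-ι q x m q≈m (suc k) = begin
    eval (fallingFactorial q (suc k)) x
      ≈⟨ eval-fallingFactorial-suc q k x ⟩
    eval (fallingFactorial q k) x * (eval q x + - ι k)
      ≈⟨ *-cong (eval-fallingFactorial-ι q x m q≈m k) (+-congʳ q≈m) ⟩
    ι ((m C k) ℕ.* k !) * (ι m + - ι k)
      ≈⟨ ι-*-difference ((m C k) ℕ.* k !) ((m C suc k) ℕ.* suc k !) m k absorb ⟩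
    ι ((m C suc k) ℕ.* suc k !) ∎
    where
    open ℕSolver.+-*-Solver
    absorb : (m C suc k) ℕ.* suc k ! ℕ.+ (m C k) ℕ.* k ! ℕ.* k ≡ (m C k) ℕ.* k ! ℕ.* m
    absorb = ≡.trans
      (solve 4 (λ c d k f → d :* ((con 1 :+ k) :* f) :+ c :* f :* k :=
        ((con 1 :+ k) :* d :+ k :* c) :* f) ≡.refl (m C k) (m C suc k) k (k !))
      (≡.trans (≡.cong (ℕ._* k !) ([k+1]nC[k+1]+knCk≡n[nCk] m k))
        (solve 3 (λ c m f → m :* c :* f := c :* f :* m) ≡.refl (m C k) m (k !)))

  -- (-1)(-2)⋯(-k) = ± k!
  fallingFactorial[-1]-annihilates : ∀ q x → eval q x ≈ - 1# → ∀ k a →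
    a * eval (fallingFactorial q k) x ≈ 0# → a * ι (k !) ≈ 0#
  fallingFactorial[-1]-annihilates q x q≈-1 zero a eq =
    trans (*-congˡ (trans (×-homo-1 1#) (sym (eval-constant 1# x)))) eq
  fallingFactorial[-1]-annihilates q x q≈-1 (suc k) a eq = begin
    a * ι (suc k !)            ≈⟨ *-congˡ (×1-homo-* (suc k) (k !)) ⟩
    a * (ι (suc k) * ι (k !))  ≈⟨ *-assoc a _ _ ⟨
    a * ι (suc k) * ι (k !)    ≈⟨ fallingFactorial[-1]-annihilates q x q≈-1 k _ eq′ ⟩
    0#                         ∎
    where
    e : Carrier
    e = eval (fallingFactorial q k) x

    -- The last factor is -1 - k = -(k+1). Its sign is dropped, since only vanishing is claimed, and
    -- k+1 is absorbed into the multiplier; this is why `a` is arbitrary.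
    eq′ : a * ι (suc k) * e ≈ 0#
    eq′ = begin
      a * ι (suc k) * e            ≈⟨ x∙yz≈xz∙y a e (ι (suc k)) ⟨
      a * (e * ι (suc k))          ≈⟨ -‿involutive _ ⟨
      - - (a * (e * ι (suc k)))    ≈⟨ -‿cong (-‿distribʳ-* a _) ⟩
      - (a * - (e * ι (suc k)))    ≈⟨ -‿cong (*-congˡ (-‿distribʳ-* e _)) ⟩
      - (a * (e * - ι (suc k)))    ≈⟨ -‿cong (*-congˡ (*-congˡ (-‿+-comm 1# (ι k)))) ⟨
      - (a * (e * (- 1# + - ι k))) ≈⟨ -‿cong (*-congˡ (*-congˡ (+-congʳ q≈-1))) ⟨
      - (a * (e * (eval q x + - ι k)))
        ≈⟨ -‿cong (*-congˡ (eval-fallingFactorial-suc q k x)) ⟨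
      - (a * eval (fallingFactorial q (suc k)) x)
        ≈⟨ -‿cong eq ⟩
      - 0#                         ≈⟨ -0#≈0# ⟩
      0#                           ∎

  -- The matrix of the C(m,i) is lower triangular with ones on the diagonal. Hence evaluation at m =
  -- k determines the k-th coefficient from the earlier ones, and strong induction applies.
  binomialExpansion-unique : ∀ n (d e : ℕ → Carrier) →
    (∀ m → sum {n} (λ i → d (toℕ i) * ι (m C toℕ i)) ≈
           sum {n} (λ i → e (toℕ i) * ι (m C toℕ i))) →
    ∀ k → k < n → d k ≈ e k
  binomialExpansion-unique n d e eq = <-rec _ step
    where
    collapse : ∀ f k → k < n → sum {n} (λ i → f (toℕ i) * ι (k C toℕ i)) ≈
               sum {k} (λ i → f (toℕ i) * ι (k C toℕ i)) + f k
    collapse f k k<n = begin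
      sum {n} (λ i → f (toℕ i) * ι (k C toℕ i))
        ≈⟨ sum-truncate (λ i → f i * ι (k C i)) k<n (λ i k<i _ →
             trans (*-congˡ (ι-cong (k>n⇒nCk≡0 k<i))) (zeroʳ (f i))) ⟩
      sum {suc k} (λ i → f (toℕ i) * ι (k C toℕ i))
        ≈⟨ sum-last k (λ i → f i * ι (k C i)) ⟩
      sum {k} (λ i → f (toℕ i) * ι (k C toℕ i)) + f k * ι (k C k)
        ≈⟨ +-congˡ (*-congˡ (trans (ι-cong (nCn≡1 k)) (×-homo-1 1#))) ⟩
      sum {k} (λ i → f (toℕ i) * ι (k C toℕ i)) + f k * 1#
        ≈⟨ +-congˡ (*-identityʳ (f k)) ⟩
      sum {k} (λ i → f (toℕ i) * ι (k C toℕ i)) + f k ∎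

    step : ∀ k → (∀ {i} → i < k → i < n → d i ≈ e i) → k < n → d k ≈ e k
    step k ih k<n = +-cancelˡ (sum {k} (λ i → d (toℕ i) * ι (k C toℕ i))) _ _ (begin
      sum {k} (λ i → d (toℕ i) * ι (k C toℕ i)) + d k ≈⟨ collapse d k k<n ⟨
      sum {n} (λ i → d (toℕ i) * ι (k C toℕ i))       ≈⟨ eq k ⟩
      sum {n} (λ i → e (toℕ i) * ι (k C toℕ i))       ≈⟨ collapse e k k<n ⟩
      sum {k} (λ i → e (toℕ i) * ι (k C toℕ i)) + e k
        ≈⟨ +-congʳ (sum-cong-< (λ i → d i * ι (k C i)) (λ i → e i * ι (k C i))
             (λ i i<k → *-congʳ (ih i<k (ℕₚ.<-trans i<k k<n)))) ⟨
      sum {k} (λ i → d (toℕ i) * ι (k C toℕ i)) + e k ∎)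

  -- Values of the Eulerian argument x + n - k - 1.

  shifted : ℕ → ℕ → Poly
  shifted n k = X +ᵖ ofℕᵖ n -ᵖ ofℕᵖ k -ᵖ ofℕᵖ 1

  eval-shifted : ∀ n k x → eval (shifted n k) x ≈ ((x + ι n) + - ι k) + - ι 1
  eval-shifted n k x = begin
    eval (shifted n k) x
      ≈⟨ eval--ᵖofℕᵖ (X +ᵖ ofℕᵖ n -ᵖ ofℕᵖ k) 1 x ⟩
    eval (X +ᵖ ofℕᵖ n -ᵖ ofℕᵖ k) x + - ι 1
      ≈⟨ +-congʳ (eval--ᵖofℕᵖ (X +ᵖ ofℕᵖ n) k x) ⟩
    (eval (X +ᵖ ofℕᵖ n) x + - ι k) + - ι 1
      ≈⟨ +-congʳ (+-congʳ (eval-+ᵖ X (ofℕᵖ n) x)) ⟩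
    ((eval X x + eval (ofℕᵖ n) x) + - ι k) + - ι 1
      ≈⟨ +-congʳ (+-congʳ (+-cong (eval-X x) (eval-constant (ι n) x))) ⟩
    ((x + ι n) + - ι k) + - ι 1 ∎

  -- For k < n the subtraction in `n ∸ suc k` is exact, so the value is a natural number.
  eval-shifted-ι : ∀ {n k} m → k < n →
    eval (shifted n k) (ι m) ≈ ι (m ℕ.+ (n ∸ suc k))
  eval-shifted-ι {n} {k} m k<n = begin
    eval (shifted n k) (ι m)          ≈⟨ eval-shifted n k (ι m) ⟩
    ((ι m + ι n) + - ι k) + - ι 1     ≈⟨ +-congʳ (+-congʳ (ι-+ m n)) ⟨
    (ι (m ℕ.+ n) + - ι k) + - ι 1     ≈⟨ +-congʳ (+-congʳ (ι-cong split)) ⟩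
    (ι (N ℕ.+ 1 ℕ.+ k) + - ι k) + - ι 1
      ≈⟨ +-congʳ (trans (+-congʳ (ι-+ (N ℕ.+ 1) k)) (//-rightDividesʳ (ι k) _)) ⟩
    ι (N ℕ.+ 1) + - ι 1               ≈⟨ trans (+-congʳ (ι-+ N 1)) (//-rightDividesʳ (ι 1) _) ⟩
    ι N                               ∎
    where
    open ℕSolver.+-*-Solver
    N : ℕ
    N = m ℕ.+ (n ∸ suc k)

    -- The summands are ordered so that k and then 1 cancel from the right.
    split : m ℕ.+ n ≡ N ℕ.+ 1 ℕ.+ k
    split = ≡.trans (≡.cong (m ℕ.+_) (≡.sym (ℕₚ.m+[n∸m]≡n k<n)))
      (solve 3 (λ m k d → m :+ (con 1 :+ k :+ d) := m :+ d :+ con 1 :+ k)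
        ≡.refl m k (n ∸ suc k))

  -- The exceptional index k = n, where the argument is x - 1 and its value at 0 is no natural
  -- number.
  eval-shifted-0 : ∀ n → eval (shifted n n) 0# ≈ - 1#
  eval-shifted-0 n = begin
    eval (shifted n n) 0#           ≈⟨ eval-shifted n n 0# ⟩
    ((0# + ι n) + - ι n) + - ι 1    ≈⟨ +-congʳ (//-rightDividesʳ (ι n) 0#) ⟩
    0# + - ι 1                      ≈⟨ +-identityˡ _ ⟩
    - ι 1                           ≈⟨ -‿cong (×-homo-1 1#) ⟩
    - 1#                            ∎

  -- Comparison of the two expansions of a single polynomial p_n.

  module _ (1/_! : ℕ → Carrier) (1/n!*n!≈1 : ∀ n → 1/ n ! * ι (n !) ≈ 1#)
           (p : Poly) (n : ℕ) (p[0]≈0 : eval p 0# ≈ 0#) (S A : ℕ → Carrier)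
           (stirling : p ≈ᵖ sumᵖ {suc n} (λ k →
             S (toℕ k) ·ᵖ fallingFactorial X (toℕ k)))
           (eulerian : p ≈ᵖ sumᵖ {suc n} (λ k →
             A (toℕ k) ·ᵖ (1/ n ! ·ᵖ fallingFactorial (shifted n (toℕ k)) n)))
           where

    -- Since (m)_k = k! C(m,k), the factorial is moved into the coefficient; what remains is an
    -- expansion in the C(m,k).
    stirling-at : ∀ m → eval p (ι m) ≈
      sum {suc n} (λ k → (ι (toℕ k !) * S (toℕ k)) * ι (m C toℕ k))
    stirling-at m = begin
      eval p (ι m)
        ≈⟨ eval-cong p (sumᵖ {suc n} (λ k → summand (toℕ k))) (ι m) stirling ⟩
      eval (sumᵖ {suc n} (λ k → summand (toℕ k))) (ι m)
        ≈⟨ eval-sumᵖ {suc n} (λ k → summand (toℕ k)) (ι m) ⟩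
      sum {suc n} (λ k → eval (summand (toℕ k)) (ι m))
        ≈⟨ sum-cong-≋ {suc n} (λ k → term (toℕ k)) ⟩
      sum {suc n} (λ k → (ι (toℕ k !) * S (toℕ k)) * ι (m C toℕ k)) ∎
      where
      summand : ℕ → Poly
      summand k = S k ·ᵖ fallingFactorial X k

      term : ∀ k → eval (summand k) (ι m) ≈ (ι (k !) * S k) * ι (m C k)
      term k = begin
        eval (summand k) (ι m)
          ≈⟨ eval-·ᵖ (S k) (fallingFactorial X k) (ι m) ⟩
        S k * eval (fallingFactorial X k) (ι m)
          ≈⟨ *-congˡ (eval-fallingFactorial-ι X (ι m) m (eval-X (ι m)) k) ⟩
        S k * ι ((m C k) ℕ.* k !)
          ≈⟨ *-congˡ (×1-homo-* (m C k) (k !)) ⟩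
        S k * (ι (m C k) * ι (k !))
          ≈⟨ x∙yz≈xz∙y (S k) _ _ ⟩
        (S k * ι (k !)) * ι (m C k)
          ≈⟨ *-congʳ (*-comm (S k) _) ⟩
        (ι (k !) * S k) * ι (m C k) ∎

    eulerianTerm : ℕ → Carrier → Carrier
    eulerianTerm k x = A k * (1/ n ! * eval (fallingFactorial (shifted n k) n) x)

    -- The falling factorial equals n! C(N,n) with N = m + n - k - 1, and 1/n! cancels the n!.
    eulerianTerm-ι : ∀ m k → k < n →
      eulerianTerm k (ι m) ≈ A k * ι ((m ℕ.+ (n ∸ suc k)) C n)
    eulerianTerm-ι m k k<n = *-congˡ (begin
      1/ n ! * eval (fallingFactorial (shifted n k) n) (ι m)
        ≈⟨ *-congˡ (eval-fallingFactorial-ι (shifted n k) (ι m) N (eval-shifted-ι m k<n) n) ⟩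
      1/ n ! * ι ((N C n) ℕ.* n !)
        ≈⟨ *-congˡ (×1-homo-* (N C n) (n !)) ⟩
      1/ n ! * (ι (N C n) * ι (n !))
        ≈⟨ x∙yz≈xz∙y (1/ n !) _ _ ⟩
      1/ n ! * ι (n !) * ι (N C n)
        ≈⟨ *-congʳ (1/n!*n!≈1 n) ⟩
      1# * ι (N C n)
        ≈⟨ *-identityˡ _ ⟩
      ι (N C n) ∎)
      where
      N : ℕ
      N = m ℕ.+ (n ∸ suc k)

    -- The term k = n is split off because `eulerianTerm-ι` covers only k < n.
    eval-eulerian : ∀ x → eval p x ≈
      sum {n} (λ k → eulerianTerm (toℕ k) x) + eulerianTerm n x
    eval-eulerian x = begin
      eval p x
        ≈⟨ eval-cong p (sumᵖ {suc n} (λ k → summand (toℕ k))) x eulerian ⟩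
      eval (sumᵖ {suc n} (λ k → summand (toℕ k))) x
        ≈⟨ eval-sumᵖ {suc n} (λ k → summand (toℕ k)) x ⟩
      sum {suc n} (λ k → eval (summand (toℕ k)) x)
        ≈⟨ sum-cong-≋ {suc n} (λ k → term (toℕ k)) ⟩
      sum {suc n} (λ k → eulerianTerm (toℕ k) x)
        ≈⟨ sum-last n (λ k → eulerianTerm k x) ⟩
      sum {n} (λ k → eulerianTerm (toℕ k) x) + eulerianTerm n x ∎
      where
      summand : ℕ → Poly
      summand k = A k ·ᵖ (1/ n ! ·ᵖ fallingFactorial (shifted n k) n)

      term : ∀ k → eval (summand k) x ≈ eulerianTerm k x
      term k = trans (eval-·ᵖ (A k) (1/ n ! ·ᵖ fallingFactorial (shifted n k) n) x)
        (*-congˡ (eval-·ᵖ (1/ n !) (fallingFactorial (shifted n k) n) x))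

    -- Evaluation at 0, where p vanishes, leaves only the term A(n,n) (-1)_n / n!. As (-1)_n is n!
    -- up to sign, cancelling it gives the claim.
    A[n]≈0 : A n ≈ 0#
    A[n]≈0 = begin
      A n                      ≈⟨ *-identityʳ (A n) ⟨
      A n * 1#                 ≈⟨ *-congˡ (1/n!*n!≈1 n) ⟨
      A n * (1/ n ! * ι (n !)) ≈⟨ *-assoc (A n) _ _ ⟨
      A n * 1/ n ! * ι (n !)
        ≈⟨ fallingFactorial[-1]-annihilates (shifted n n) 0# (eval-shifted-0 n) n _
             (trans (*-assoc (A n) _ _) lastTerm≈0) ⟩
      0#                       ∎
      where
      term≈0 : ∀ k → 0 ≤ k → k < n → eulerianTerm k 0# ≈ 0#
      term≈0 k _ k<n = begin
        eulerianTerm k 0#          ≈⟨ eulerianTerm-ι 0 k k<n ⟩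
        -- The bound n - (k+1) < n is monotonicity of subtraction, with n read as `n ∸ 0`.
        A k * ι ((n ∸ suc k) C n)  ≈⟨ *-congˡ (ι-cong (k>n⇒nCk≡0 (ℕₚ.∸-monoʳ-< (s≤s z≤n) k<n))) ⟩
        A k * 0#                   ≈⟨ zeroʳ (A k) ⟩
        0#                         ∎

      lastTerm≈0 : eulerianTerm n 0# ≈ 0#
      lastTerm≈0 = begin
        eulerianTerm n 0#
          ≈⟨ +-identityˡ _ ⟨
        0# + eulerianTerm n 0#
          ≈⟨ +-congʳ (sum-truncate (λ k → eulerianTerm k 0#) z≤n term≈0) ⟨
        sum {n} (λ k → eulerianTerm (toℕ k) 0#) + eulerianTerm n 0#
          ≈⟨ eval-eulerian 0# ⟨
        eval p 0#
          ≈⟨ p[0]≈0 ⟩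
        0# ∎

    -- Vandermonde's identity expands each C(m+n-j-1, n), and exchanging the sums collects the
    -- coefficient of C(m,i). The index j starts at 0, so `n ∸ suc j` is the n - j of the theorem.
    eulerian-at : ∀ m → eval p (ι m) ≈
      sum {suc n} (λ i →
        sum {n} (λ j → ι ((n ∸ suc (toℕ j)) C (n ∸ toℕ i)) * A (toℕ j)) * ι (m C toℕ i))
    eulerian-at m = begin
      eval p (ι m)
        ≈⟨ eval-eulerian (ι m) ⟩
      sum {n} (λ j → eulerianTerm (toℕ j) (ι m)) + eulerianTerm n (ι m)
        ≈⟨ +-congˡ (trans (*-congʳ A[n]≈0) (zeroˡ _)) ⟩
      sum {n} (λ j → eulerianTerm (toℕ j) (ι m)) + 0#
        ≈⟨ +-identityʳ _ ⟩
      sum {n} (λ j → eulerianTerm (toℕ j) (ι m))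
        ≈⟨ sum-cong-≋ {n} (λ j → trans (eulerianTerm-ι m (toℕ j) (toℕ<n j)) (expand (toℕ j))) ⟩
      sum {n} (λ j → sum {suc n} (λ i → u i j * ι (m C toℕ i)))
        ≈⟨ ∑-comm {n} {suc n} (λ j i → u i j * ι (m C toℕ i)) ⟩
      sum {suc n} (λ i → sum {n} (λ j → u i j * ι (m C toℕ i)))
        ≈⟨ sum-cong-≋ {suc n} (λ i → *-distribʳ-sum {n} (ι (m C toℕ i)) (u i)) ⟨
      sum {suc n} (λ i → sum {n} (u i) * ι (m C toℕ i)) ∎
      where
      u : Fin (suc n) → Fin n → Carrier
      u i j = ι ((n ∸ suc (toℕ j)) C (n ∸ toℕ i)) * A (toℕ j)

      expand : ∀ j → A j * ι ((m ℕ.+ (n ∸ suc j)) C n) ≈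
        sum {suc n} (λ i → ι ((n ∸ suc j) C (n ∸ toℕ i)) * A j * ι (m C toℕ i))
      expand j = begin
        A j * ι ((m ℕ.+ N) C n)
          ≈⟨ *-congˡ (ι-cong (vandermonde m N n)) ⟨
        A j * ι (ℕSum.sum v)
          ≈⟨ *-congˡ (ι-sum v) ⟩
        A j * sum (λ i → ι (v i))
          ≈⟨ *-distribˡ-sum (A j) (λ i → ι (v i)) ⟩
        sum (λ i → A j * ι (v i))
          ≈⟨ sum-cong-≋ {suc n} (λ i → term (m C toℕ i) (N C (n ∸ toℕ i))) ⟩
        sum {suc n} (λ i → ι (N C (n ∸ toℕ i)) * A j * ι (m C toℕ i)) ∎
        where
        N : ℕ
        N = n ∸ suc j

        v : Fin (suc n) → ℕ
        v i = (m C toℕ i) ℕ.* (N C (n ∸ toℕ i))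

        term : ∀ a b → A j * ι (a ℕ.* b) ≈ ι b * A j * ι a
        term a b = begin
          A j * ι (a ℕ.* b)  ≈⟨ *-congˡ (×1-homo-* a b) ⟩
          A j * (ι a * ι b)  ≈⟨ x∙yz≈xz∙y (A j) _ _ ⟩
          A j * ι b * ι a    ≈⟨ *-congʳ (*-comm (A j) _) ⟩
          ι b * A j * ι a    ∎

    -- For j ≥ k the upper entry n-j-1 is below n-k, so the binomial vanishes. For j < k symmetry
    -- applies, because (n-j-1) - (k-j-1) = n-k.
    truncateBinomials : ∀ k → k ≤ n →
      sum {n} (λ j → ι ((n ∸ suc (toℕ j)) C (n ∸ k)) * A (toℕ j)) ≈
      sum {k} (λ j → ι ((n ∸ suc (toℕ j)) C (k ∸ suc (toℕ j))) * A (toℕ j))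
    truncateBinomials k k≤n = trans
      (sum-truncate (λ j → ι ((n ∸ suc j) C (n ∸ k)) * A j) k≤n λ j k≤j j<n →
        trans (*-congʳ (ι-cong (k>n⇒nCk≡0 (ℕₚ.∸-monoʳ-< (s≤s k≤j) j<n)))) (zeroˡ (A j)))
      (sum-cong-< (λ j → ι ((n ∸ suc j) C (n ∸ k)) * A j)
        (λ j → ι ((n ∸ suc j) C (k ∸ suc j)) * A j)
        (λ j j<k → *-congʳ (ι-cong (reflect j j<k))))
      where
      reflect : ∀ j → j < k → (n ∸ suc j) C (n ∸ k) ≡ (n ∸ suc j) C (k ∸ suc j)
      reflect j j<k = ≡.sym (≡.trans
        (nCk≡nC[n∸k] (ℕₚ.∸-monoˡ-≤ (suc j) k≤n))
        (≡.cong ((n ∸ suc j) C_) (≡.trans (ℕₚ.∸-+-assoc n (suc j) (k ∸ suc j))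
          (≡.cong (n ∸_) (ℕₚ.m+[n∸m]≡n j<k)))))

    -- Uniqueness of the n+1 coefficients gives k! S(k); multiplication by 1/k! isolates S(k).
    stirling-from-eulerian : ∀ k → k ≤ n → S k ≈
      1/ k ! * sum {k} (λ j → ι ((n ∸ suc (toℕ j)) C (k ∸ suc (toℕ j))) * A (toℕ j))
    stirling-from-eulerian k k≤n = begin
      S k
        ≈⟨ *-identityˡ (S k) ⟨
      1# * S k
        ≈⟨ *-congʳ (1/n!*n!≈1 k) ⟨
      1/ k ! * ι (k !) * S k
        ≈⟨ *-assoc (1/ k !) _ _ ⟩
      1/ k ! * (ι (k !) * S k)
        ≈⟨ *-congˡ (binomialExpansion-unique (suc n) (λ i → ι (i !) * S i)
             (λ i → sum {n} (λ j → ι ((n ∸ suc (toℕ j)) C (n ∸ i)) * A (toℕ j)))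
             (λ m → trans (sym (stirling-at m)) (eulerian-at m)) k (s≤s k≤n)) ⟩
      1/ k ! * sum {n} (λ j → ι ((n ∸ suc (toℕ j)) C (n ∸ k)) * A (toℕ j))
        ≈⟨ *-congˡ (truncateBinomials k k≤n) ⟩
      1/ k ! * sum {k} (λ j → ι ((n ∸ suc (toℕ j)) C (k ∸ suc (toℕ j))) * A (toℕ j)) ∎

-- Inverse factorials in ℂ, and the specialisation to complex polynomials.

open import Algebra.Definitions.RawMonoid ℚ.+-0-rawMonoid using () renaming (_×_ to _×ℚ_)

-- Induction on m by 1/d + m/d = (m+1)/d. This is checked on unnormalised fractions, where equality
-- is cross-multiplication in ℤ.
m×1/d≡m/d : ∀ m d .{{_ : ℕ.NonZero d}} → m ×ℚ (ℤ.+ 1 ℚ./ d) ≡ ℤ.+ m ℚ./ d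
m×1/d≡m/d zero    (suc d) = ≡.sym (ℚₚ.fromℚᵘ-cong {ℚᵘ.mkℚᵘ (ℤ.+ 0) d} {ℚᵘ.0ℚᵘ} (ℚᵘ.*≡* ≡.refl))
m×1/d≡m/d (suc m) (suc d) = ≡.trans (≡.cong ((ℤ.+ 1 ℚ./ suc d) ℚ.+_) (m×1/d≡m/d m (suc d)))
  (ℚₚ.toℚᵘ-injective (begin
    ℚ.toℚᵘ (ℚ.fromℚᵘ u ℚ.+ ℚ.fromℚᵘ v)
      ≈⟨ ℚₚ.toℚᵘ-homo-+ (ℚ.fromℚᵘ u) (ℚ.fromℚᵘ v) ⟩
    ℚ.toℚᵘ (ℚ.fromℚᵘ u) ℚᵘ.+ ℚ.toℚᵘ (ℚ.fromℚᵘ v)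
      ≈⟨ ℚᵘₚ.+-cong (ℚₚ.toℚᵘ-fromℚᵘ u) (ℚₚ.toℚᵘ-fromℚᵘ v) ⟩
    u ℚᵘ.+ v
      ≈⟨ ℚᵘ.*≡* (solve 2 (λ m d → (con (ℤ.+ 1) :* d :+ m :* d) :* d :=
           (con (ℤ.+ 1) :+ m) :* (d :* d)) ≡.refl (ℤ.+ m) (ℤ.+ suc d)) ⟩
    w
      ≈⟨ ℚₚ.toℚᵘ-fromℚᵘ w ⟨
    ℚ.toℚᵘ (ℚ.fromℚᵘ w) ∎))
  where
  open SetoidReasoning ℚᵘₚ.≃-setoid
  open ℤSolver.+-*-Solver
  u v w : ℚᵘ.ℚᵘ
  u = ℚᵘ.mkℚᵘ (ℤ.+ 1) d
  v = ℚᵘ.mkℚᵘ (ℤ.+ m) d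
  w = ℚᵘ.mkℚᵘ (ℤ.+ suc m) d

n/n≡1 : ∀ n .{{_ : ℕ.NonZero n}} → ℤ.+ n ℚ./ n ≡ 1ℚ
n/n≡1 (suc n) = ℚₚ.fromℚᵘ-cong {ℚᵘ.mkℚᵘ (ℤ.+ suc n) n} {ℚᵘ.1ℚᵘ}
  (ℚᵘ.*≡* (solve 1 (λ m → m :* con (ℤ.+ 1) := con (ℤ.+ 1) :* m) ≡.refl (ℤ.+ suc n)))
  where open ℤSolver.+-*-Solver

open import Defs
open CommutativeRing ℂ-commutativeRing using (+-congˡ; *-identityʳ; setoid; semiring)

×ᶜ-ofℚ : ∀ m q → m ×ᶜ ofℚ q ≈ ofℚ (m ×ℚ q)
×ᶜ-ofℚ zero    q = CommutativeRing.refl ℂ-commutativeRing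
×ᶜ-ofℚ (suc m) q = begin
  ofℚ q + m ×ᶜ ofℚ q      ≈⟨ +-congˡ {ofℚ q} (×ᶜ-ofℚ m q) ⟩
  ofℚ q + ofℚ (m ×ℚ q)    ≈⟨ mk≈ᶜ (ofℚᴿ-+ q (m ×ℚ q)) (ofℚᴿ-+ 0ℚ 0ℚ) ⟨
  ofℚ (q ℚ.+ (m ×ℚ q))    ∎
  where open SetoidReasoning setoid

-- As `ofℕ (n !)` is an n!-fold sum of ones, the product is an n!-fold sum of copies of 1/n!, which
-- is computed in ℚ.
1/n!*n!≈1 : ∀ n → 1/ n ! * ofℕ (n !) ≈ 1#
1/n!*n!≈1 n = begin
  1/ n ! * ((n !) ×ᶜ 1#)    ≈⟨ ×-comm-* (n !) (1/ n !) 1# ⟩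
  (n !) ×ᶜ (1/ n ! * 1#)    ≈⟨ ×-congʳ (n !) (*-identityʳ (1/ n !)) ⟩
  (n !) ×ᶜ 1/ n !           ≈⟨ ×ᶜ-ofℚ (n !) (ℤ.+ 1 ℚ./ n !) ⟩
  ofℚ ((n !) ×ℚ (ℤ.+ 1 ℚ./ n !))
    ≡⟨ ≡.cong ofℚ (≡.trans (m×1/d≡m/d (n !) (n !)) (n/n≡1 (n !))) ⟩
  1#                      ∎
  where
  open SetoidReasoning setoid
  open Mult semiring using (×-comm-*; ×-congʳ)
  instance
    n!≢0 : ℕ.NonZero (n !)
    n!≢0 = ℕₚ._!≢0 n

theorem3p3 : (p : ℕ → Poly) →
    (∀ n → HasDegree (p n) n) →
    p 0 ≈ᵖ 1ᵖ →
    (∀ n → 1 ≤ n → eval (p n) 0# ≈ 0#) →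
    (S₂ A : ℕ → ℕ → ℂ) →
    IsStirling₂ p S₂ →
    IsEulerian p A →
    ∀ n k → 1 ≤ n → 1 ≤ k → k ≤ n →
    S₂ n k ≈
    1/ k ! * sum {k} (λ i → let j = suc (toℕ i) in ofℕ ((n ∸ j) C (k ∸ j)) * A n (j ∸ 1))
theorem3p3 p _ _ p[0]≈0 S₂ A stirling eulerian n k 1≤n _ k≤n =
  -- With j = i + 1 the entry `A n (j ∸ 1)` reduces to `A n (toℕ i)`, so the formula indexed from 0
  -- is the claim itself.
  stirling-from-eulerian 1/_! 1/n!*n!≈1 (p n) n (p[0]≈0 n 1≤n) (S₂ n) (A n)
    (stirling n) (eulerian n) k k≤n
  where open RingExpansions ℂ-commutativeRing using (stirling-from-eulerian)
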